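{- Let $n\ge 5$ and let $G$ be a unicyclic graph on $n$ vertices. Suppose $G\not\cong C_n$ and the degree sequence of $G$ is not $(3,2,\ldots,2,1)$ (one vertex of degree $3$, $n-2$ of degree $2$, one of degree $1$). Then $\mathrm{irr}_t(G)\ge 4n-8$. Equality holds if and only if the degree sequence of $G$ is $(3,3,2,\ldots,2,1,1)$, i.e. two vertices of degree $3$, $n-4$ vertices of degree $2$ and two vertices of degree $1$.
   Context: A unicyclic graph is a simple connected graph whose number of edges equals its number of vertices. For a graph $G=(V,E)$ and $w\in V$, $d_G(w)$ is the degree of $w$. The total irregularity is $\mathrm{irr}_t(G)=\frac12\sum_{x,y\in V}|d_G(x)-d_G(y)|$, where the sum runs over all ordered pairs of vertices. $C_n$ is the cycle on $n$ vertices. Degree sequences are listed in nonincreasing order. -}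

module Defs where

import Algebra.Properties.Semiring.Sum
open import Data.Fin.Base using (Fin; toℕ)
open import Data.Fin.Permutation using (Permutation; _⟨$⟩ʳ_)
import Data.Fin.Properties as Fin
open import Data.Integer.Base using (+_)
open import Data.List.Base using (List; length; map; filter; allFin; cartesianProduct)
import Data.List.Sort
open import Data.Nat.Base using (ℕ; suc; s≤s; _≤_; ∣_-_∣)
import Data.Nat.Properties as ℕ
open import Data.Product.Base using (_×_; _,_; proj₁; proj₂; Σ-syntax)
open import Data.Rational.Base using (ℚ; ½; _*_; _/_)
open import Data.Sum.Base using (_⊎_; inj₁; inj₂; swap; [_,_])
open import Function.Bundles using (_⇔_)
open import Level using (0ℓ)
open import Relation.Binary.Core using (Rel)
open import Relation.Binary.Construct.Closure.ReflexiveTransitive using (Star)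
open import Relation.Binary.Definitions using (Decidable; Symmetric)
open import Relation.Binary.Properties.DecTotalOrder ℕ.≤-decTotalOrder using (≥-decTotalOrder)
open import Relation.Binary.PropositionalEquality using (_≡_; refl; sym; trans; cong)
open import Relation.Nullary using (¬_)
open import Relation.Nullary.Decidable using (_×-dec_; _⊎-dec_)

open Algebra.Properties.Semiring.Sum ℕ.+-*-semiring using (sum)
open Data.List.Sort ≥-decTotalOrder using (sort)

record SimpleGraph (n : ℕ) : Set₁ where
  infix 4 _~_ _~?_
  field
    _~_      : Rel (Fin n) 0ℓ
    _~?_     : Decidable _~_
    ~-sym    : Symmetric _~_
    ~-irrefl : ∀ {x} → ¬ (x ~ x)

  degree : Fin n → ℕ
  degree x = length (filter (x ~?_) (allFin n))

  -- Each edge {x , y} is listed once, as the ordered pair with x < y.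
  edges : List (Fin n × Fin n)
  edges = filter (λ e → (proj₁ e Fin.<? proj₂ e) ×-dec (proj₁ e ~? proj₂ e))
                 (cartesianProduct (allFin n) (allFin n))

  Connected : Set
  Connected = ∀ x y → Star _~_ x y

  Unicyclic : Set
  Unicyclic = Connected × length edges ≡ n

  -- `sort` is taken with respect to _≥_, so the result is nonincreasing.
  degreeSequence : List ℕ
  degreeSequence = sort (map degree (allFin n))

  irrₜ : ℚ
  irrₜ = ½ * (+ sum (λ x → sum (λ y → ∣ degree x - degree y ∣)) / 1)

open SimpleGraph public
  using (degree; edges; Connected; Unicyclic; degreeSequence; irrₜ)

infix 4 _≅_

_≅_ : ∀ {m n} → SimpleGraph m → SimpleGraph n → Set
_≅_ {m} {n} G H =
  Σ[ π ∈ Permutation m n ] (∀ x y → (x G.~ y) ⇔ ((π ⟨$⟩ʳ x) H.~ (π ⟨$⟩ʳ y)))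
  where
  module G = SimpleGraph G
  module H = SimpleGraph H

-- y is the cyclic successor of x, i.e. y = x + 1 modulo n.
Next : ∀ {n} → Rel (Fin n) 0ℓ
Next {n} x y = suc (toℕ x) ≡ toℕ y ⊎ (suc (toℕ x) ≡ n × toℕ y ≡ 0)

next? : ∀ {n} → Decidable (Next {n})
next? {n} x y =
  (suc (toℕ x) ℕ.≟ toℕ y) ⊎-dec ((suc (toℕ x) ℕ.≟ n) ×-dec (toℕ y ℕ.≟ 0))

Next-irrefl : ∀ {n} → 3 ≤ n → (x : Fin n) → ¬ Next x x
Next-irrefl 3≤n x (inj₁ eq) = ℕ.1+n≢n eq
Next-irrefl 3≤n x (inj₂ (eq , x≡0)) with trans (sym eq) (cong suc x≡0)
Next-irrefl (s≤s ()) x (inj₂ (eq , x≡0)) | refl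

-- For n = 1 the adjacency below would have a loop, and for n = 2 it would be a single edge.
C : ∀ n → 3 ≤ n → SimpleGraph n
C n 3≤n = record
  { _~_      = λ x y → Next x y ⊎ Next y x
  ; _~?_     = λ x y → next? x y ⊎-dec next? y x
  ; ~-sym    = swap
  ; ~-irrefl = λ {x} → [ Next-irrefl 3≤n x , Next-irrefl 3≤n x ]
  }

{-# OPTIONS --safe #-}
module Submission where

-- Let ℓ be the number of leaves, e the sum of the excesses d(x) - 2 over the vertices of degree at
-- least 3, and b the number of those vertices. The handshake lemma gives ℓ = e ≥ b.
-- If ℓ = 0, the graph is 2-regular and a non-backtracking walk first returns at its starting vertex,
-- having traversed a cycle that contains every vertex by connectivity; if ℓ = 1, the degree sequence
-- is (3, 2, …, 2, 1). Otherwise, splitting |d(x) - d(y)| into its parts below and above 2 and keeping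
-- in the latter only the pairs with exactly one vertex of degree at least 3 gives
-- 2 irrₜ ≥ 4 n ℓ - 2 ℓ² - 2 ℓ b, which together with ℓ + b ≤ n exceeds 8 n - 16 unless ℓ = b = 2.

open import Defs
import Algebra.Properties.Semiring.Sum
open import Data.Bool.Base using (true; false; if_then_else_)
open import Data.Fin.Base as Fin using (Fin; zero; suc; toℕ; fromℕ<)
import Data.Fin.Properties as Fin
open import Data.Fin.Permutation using (permutation)
open import Data.Integer.Base as ℤ using (+_; _-_)
import Data.Integer.Properties as ℤ
open import Data.List.Base using
  (List; _∷_; []; _++_; replicate; length; map; filter; tabulate; allFin; cartesianProduct)
import Data.List.Properties as List
open import Data.List.Membership.Propositional using (_∈_)
open import Data.List.Membership.Propositional.Properties using (∈-filter⁺; ∈-filter⁻; ∈-allFin)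
open import Data.List.Relation.Binary.Permutation.Propositional using (↭-sym)
open import Data.List.Relation.Binary.Permutation.Propositional.Properties using (map⁺; All-resp-↭)
open import Data.List.Relation.Unary.All as All using (All; []; _∷_)
import Data.List.Relation.Unary.All.Properties as All
open import Data.List.Relation.Unary.AllPairs using (AllPairs; []; _∷_)
open import Data.List.Relation.Unary.Any using (here; there)
open import Data.List.Relation.Unary.Linked.Properties using (Linked⇒AllPairs)
open import Data.List.Relation.Unary.Unique.Propositional using (Unique)
import Data.List.Relation.Unary.Unique.Propositional.Properties as Unique
import Data.List.Sort
open import Data.Nat.Base as ℕ using
  (ℕ; zero; suc; _∸_; _+_; _*_; ∣_-_∣; _<_; z≤n; s≤s; s≤s⁻¹) renaming (_≤_ to _≤ℕ_)
import Data.Nat.ListAction as List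
import Data.Nat.ListAction.Properties as List
open import Data.Nat.Properties as ℕ using (≤-trans; m≤m+n)
open import Data.Nat.Tactic.RingSolver using (solve-∀)
open import Data.Product.Base using (_×_; _,_; proj₁; proj₂; ∃)
open import Data.Rational.Base as ℚ using (½; _/_; _≥_; toℚᵘ)
import Data.Rational.Properties as ℚ
open import Data.Rational.Unnormalised.Base as ℚᵘ using (mkℚᵘ; *≡*; *≤*)
import Data.Rational.Unnormalised.Properties as ℚᵘ
open import Data.Sum.Base using (_⊎_; inj₁; inj₂; swap; [_,_]′)
open import Function.Base using (_∘_; id; flip)
open import Function.Bundles using (_⇔_; mk⇔; Equivalence)
open import Level using (Level)
open import Relation.Binary.Construct.Closure.ReflexiveTransitive using (Star; ε; _◅_)
open import Relation.Binary.Definitions using (tri<; tri≈; tri>)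
open import Relation.Binary.Properties.DecTotalOrder ℕ.≤-decTotalOrder using (≥-decTotalOrder)
open import Relation.Binary.PropositionalEquality
  using (_≡_; _≢_; _≗_; refl; sym; trans; cong; cong₂; subst; subst₂; module ≡-Reasoning)
open import Relation.Nullary using (Dec; yes; no; does; ¬_; contradiction)
open import Relation.Nullary.Decidable using (_×-dec_; dec-true; dec-false)
open import Relation.Unary using (Pred; Decidable)

open Algebra.Properties.Semiring.Sum ℕ.+-*-semiring
  using (sum; sum-cong-≗; ∑-distrib-+; ∑-comm; *-distribˡ-sum; *-distribʳ-sum)
open Data.List.Sort ≥-decTotalOrder using (sort-↭; sort-↗)

private
  variable
    a p : Level
    A : Set a
    n : ℕ

-- Sums over Fin n

sum-const : ∀ n c → sum {n} (λ _ → c) ≡ n * c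
sum-const zero    c = refl
sum-const (suc n) c = cong (λ s → c + s) (sum-const n c)

sum-mono-≤ : {f g : Fin n → ℕ} → (∀ i → f i ≤ℕ g i) → sum f ≤ℕ sum g
sum-mono-≤ {zero}  f≤g = z≤n
sum-mono-≤ {suc n} f≤g = ℕ.+-mono-≤ (f≤g zero) (sum-mono-≤ (f≤g ∘ suc))

term≤sum : (f : Fin n → ℕ) → ∀ i → f i ≤ℕ sum f
term≤sum f zero    = m≤m+n _ _
term≤sum f (suc i) = ≤-trans (term≤sum (f ∘ suc) i) (ℕ.m≤n+m _ (f zero))

-- A deficit at one index could not be made up at another. For `branch ≤ excess` this turns equality
-- of the totals into equality at every vertex, which caps the degrees at 3.
sum-≤-≡⇒≗ : {f g : Fin n → ℕ} → (∀ i → f i ≤ℕ g i) → sum f ≡ sum g → f ≗ g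
sum-≤-≡⇒≗ {suc n} {f} {g} f≤g eq = λ where
    zero    → head≡
    (suc i) → sum-≤-≡⇒≗ (f≤g ∘ suc) tail≡ i
  where
  tail≤ : sum (f ∘ suc) ≤ℕ sum (g ∘ suc)
  tail≤ = sum-mono-≤ (f≤g ∘ suc)
  head≡ : f zero ≡ g zero
  head≡ = ℕ.≤-antisym (f≤g zero)
    (ℕ.+-cancelʳ-≤ _ _ _ (≤-trans (ℕ.+-monoʳ-≤ (g zero) tail≤) (ℕ.≤-reflexive (sym eq))))
  tail≡ : sum (f ∘ suc) ≡ sum (g ∘ suc)
  tail≡ = ℕ.+-cancelˡ-≡ (f zero) _ _ (trans eq (cong (_+ sum (g ∘ suc)) (sym head≡)))

∑∑-distrib-+ : (f g : Fin n → Fin n → ℕ) →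
  sum (λ x → sum (λ y → f x y + g x y)) ≡ sum (λ x → sum (f x)) + sum (λ x → sum (g x))
∑∑-distrib-+ f g =
  trans (sum-cong-≗ λ x → ∑-distrib-+ (f x) (g x)) (∑-distrib-+ (sum ∘ f) (sum ∘ g))

∑∑-distrib-* : (f g : Fin n → ℕ) → sum (λ x → sum (λ y → f x * g y)) ≡ sum f * sum g
∑∑-distrib-* f g =
  trans (sum-cong-≗ λ x → sym (*-distribˡ-sum (f x) g)) (sym (*-distribʳ-sum (sum g) f))

∑∑-+ : (f : Fin n → ℕ) → sum (λ x → sum (λ y → f x + f y)) ≡ n * sum f + n * sum f
∑∑-+ {n} f = begin
  sum (λ x → sum (λ y → f x + f y))
    ≡⟨ ∑∑-distrib-+ (λ x y → f x) (λ x y → f y) ⟩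
  sum (λ x → sum {n} (λ y → f x)) + sum {n} (λ x → sum f)
    ≡⟨ cong₂ _+_ (sum-cong-≗ λ x → sum-const n (f x)) (sum-const n (sum f)) ⟩
  sum (λ x → n * f x) + n * sum f
    ≡⟨ cong (_+ n * sum f) (*-distribˡ-sum n f) ⟨
  n * sum f + n * sum f ∎
  where open ≡-Reasoning

-- Counting and the handshake lemma

indicator : {P : Set p} → Dec P → ℕ
indicator P? = if does P? then 1 else 0

indicator-yes : {P : Set p} (P? : Dec P) → P → indicator P? ≡ 1
indicator-yes P? p = cong (λ b → if b then 1 else 0) (dec-true P? p)

indicator-no : {P : Set p} (P? : Dec P) → ¬ P → indicator P? ≡ 0
indicator-no P? ¬p = cong (λ b → if b then 1 else 0) (dec-false P? ¬p)

length-filter-tabulate : {P : Pred A p} (P? : Decidable P) (f : Fin n → A) →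
  length (filter P? (tabulate f)) ≡ sum (λ i → indicator (P? (f i)))
length-filter-tabulate {n = zero}  P? f = refl
length-filter-tabulate {n = suc n} P? f with does (P? (f zero))
... | true  = cong suc (length-filter-tabulate P? (f ∘ suc))
... | false = length-filter-tabulate P? (f ∘ suc)

-- The first factor is `tabulate f` and not just `allFin m` because the induction replaces `f` by
-- `f ∘ suc`.
length-filter-cartesianProduct : ∀ {m} {P : Pred (Fin m × Fin n) p} (P? : Decidable P) →
  ∀ {k} (f : Fin k → Fin m) →
  length (filter P? (cartesianProduct (tabulate f) (allFin n))) ≡
  sum (λ i → sum (λ j → indicator (P? (f i , j))))
length-filter-cartesianProduct P? {zero} f = refl
length-filter-cartesianProduct {n = n} P? {suc k} f = begin
  length (filter P? (row ++ rest))
    ≡⟨ cong length (List.filter-++ P? row rest) ⟩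
  length (filter P? row ++ filter P? rest)
    ≡⟨ List.length-++ (filter P? row) ⟩
  length (filter P? row) + length (filter P? rest)
    ≡⟨ cong₂ _+_ row-length (length-filter-cartesianProduct P? (f ∘ suc)) ⟩
  sum (λ i → sum (λ j → indicator (P? (f i , j)))) ∎
  where
  open ≡-Reasoning
  row  = map (f zero ,_) (allFin n)
  rest = cartesianProduct (tabulate (f ∘ suc)) (allFin n)
  row-length : length (filter P? row) ≡ sum (λ j → indicator (P? (f zero , j)))
  row-length = trans (cong (length ∘ filter P?) (List.map-tabulate id (f zero ,_)))
                     (length-filter-tabulate P? (f zero ,_))

module _ (G : SimpleGraph n) where
  open SimpleGraph G using (_~_; _~?_; ~-sym; ~-irrefl)

  degree-sum : ∀ x → degree G x ≡ sum (λ y → indicator (x ~? y))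
  degree-sum x = length-filter-tabulate (x ~?_) id

  ordered? : ∀ x y → Dec (x Fin.< y × x ~ y)
  ordered? x y = (x Fin.<? y) ×-dec (x ~? y)

  -- Two adjacent vertices are distinct, so exactly one of the two orders is increasing.
  indicator-split : ∀ x y →
    indicator (x ~? y) ≡ indicator (ordered? x y) + indicator (ordered? y x)
  indicator-split x y with x ~? y
  ... | no x≁y = sym (cong₂ _+_ (indicator-no (x Fin.<? y ×-dec no x≁y) (x≁y ∘ proj₂))
                                (indicator-no (ordered? y x) (x≁y ∘ ~-sym ∘ proj₂)))
  ... | yes x~y with Fin.<-cmp x y
  ...   | tri< x<y _ x≯y = sym (cong₂ _+_ (indicator-yes (x Fin.<? y ×-dec yes x~y) (x<y , x~y))
                                          (indicator-no (ordered? y x) (x≯y ∘ proj₁)))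
  ...   | tri> x≮y _ x>y = sym (cong₂ _+_ (indicator-no (x Fin.<? y ×-dec yes x~y) (x≮y ∘ proj₁))
                                          (indicator-yes (ordered? y x) (x>y , ~-sym x~y)))
  ...   | tri≈ _ refl _  = contradiction x~y ~-irrefl

  -- The degrees count adjacent ordered pairs. Exchanging the order of summation identifies the
  -- decreasing pairs with the increasing ones, and the latter are the listed edges.
  handshake : sum (degree G) ≡ length (edges G) + length (edges G)
  handshake = begin
    sum (degree G)
      ≡⟨ sum-cong-≗ degree-sum ⟩
    sum (λ x → sum (λ y → indicator (x ~? y)))
      ≡⟨ sum-cong-≗ (λ x → sum-cong-≗ (indicator-split x)) ⟩
    sum (λ x → sum (λ y → o x y + o y x))
      ≡⟨ ∑∑-distrib-+ o (flip o) ⟩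
    sum (λ x → sum (λ y → o x y)) + sum (λ x → sum (λ y → o y x))
      ≡⟨ cong (λ s → sum (sum ∘ o) + s) (∑-comm o) ⟨
    sum (sum ∘ o) + sum (sum ∘ o)
      ≡⟨ cong (λ s → s + s) (length-filter-cartesianProduct (λ (x , y) → ordered? x y) id) ⟨
    length (edges G) + length (edges G) ∎
    where
    open ≡-Reasoning
    o : Fin n → Fin n → ℕ
    o x y = indicator (ordered? x y)

  -- There is a second vertex, and a path to it begins with an edge at `x`.
  1≤degree : 2 ≤ℕ n → Connected G → ∀ x → 1 ≤ℕ degree G x
  1≤degree (s≤s (s≤s _)) conn x with other x
    where
    other : ∀ {k} (x : Fin (suc (suc k))) → ∃ (x ≢_)
    other zero    = suc zero , λ ()
    other (suc x) = zero , λ ()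
  ... | y , x≢y with conn x y
  ...   | ε = contradiction refl x≢y
  ...   | _◅_ {j = z} x~z _ = subst₂ _≤ℕ_ (indicator-yes (x ~? z) x~z) (sym (degree-sum x))
                                (term≤sum (λ y → indicator (x ~? y)) z)

  -- Sorting only permutes the degrees. This carries counts of vertices over to counts of entries
  -- and back.
  sum-degreeSequence : (f : ℕ → ℕ) →
    List.sum (map f (degreeSequence G)) ≡ sum (f ∘ degree G)
  sum-degreeSequence f = begin
    List.sum (map f (degreeSequence G))
      ≡⟨ List.sum-↭ (map⁺ f (sort-↭ (map (degree G) (allFin n)))) ⟩
    List.sum (map f (map (degree G) (allFin n)))
      ≡⟨ cong List.sum (List.map-∘ (allFin n)) ⟨
    List.sum (map (f ∘ degree G) (allFin n))
      ≡⟨ sum-tabulate (f ∘ degree G) id ⟩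
    sum (f ∘ degree G) ∎
    where
    open ≡-Reasoning
    sum-tabulate : ∀ {k} (g : A → ℕ) (h : Fin k → A) →
      List.sum (map g (tabulate h)) ≡ sum (g ∘ h)
    sum-tabulate {k = zero}  g h = refl
    sum-tabulate {k = suc k} g h = cong (λ s → g (h zero) + s) (sum-tabulate g (h ∘ suc))

-- Degrees

-- By truncation `excess` is the positive part of `d - 2`; for `d ≥ 1` its negative part is `leaf`.
leaf through branch excess : ℕ → ℕ
leaf 1 = 1
leaf _ = 0
through 2 = 1
through _ = 0
branch (suc (suc (suc _))) = 1
branch _                   = 0
excess d = d ∸ 2

degree+leaf : ∀ {d} → 1 ≤ℕ d → d + leaf d ≡ 2 + excess d
degree+leaf {1}                 _ = refl
degree+leaf {2}                 _ = refl
degree+leaf {suc (suc (suc d))} _ = ℕ.+-identityʳ _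

leaf+through+branch : ∀ {d} → 1 ≤ℕ d → leaf d + (through d + branch d) ≡ 1
leaf+through+branch {1}                 _ = refl
leaf+through+branch {2}                 _ = refl
leaf+through+branch {suc (suc (suc d))} _ = refl

≤1⇒through≡0 : ∀ {d} → d ≤ℕ 1 → through d ≡ 0
≤1⇒through≡0 {0} _ = refl
≤1⇒through≡0 {1} _ = refl
≤1⇒through≡0 {suc (suc _)} (s≤s ())

≤2⇒branch≡0 : ∀ {d} → d ≤ℕ 2 → branch d ≡ 0
≤2⇒branch≡0 {0} _ = refl
≤2⇒branch≡0 {1} _ = refl
≤2⇒branch≡0 {2} _ = refl
≤2⇒branch≡0 {suc (suc (suc _))} (s≤s (s≤s ()))

branch≤excess : ∀ d → branch d ≤ℕ excess d
branch≤excess 0                   = z≤n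
branch≤excess 1                   = z≤n
branch≤excess 2                   = z≤n
branch≤excess (suc (suc (suc d))) = s≤s z≤n

excess≤1⇒branch : ∀ {d} → excess d ≤ℕ 1 → branch d ≡ excess d
excess≤1⇒branch {0} _ = refl
excess≤1⇒branch {1} _ = refl
excess≤1⇒branch {2} _ = refl
excess≤1⇒branch {3} _ = refl
excess≤1⇒branch {suc (suc (suc (suc d)))} (s≤s ())

branch≡excess⇒≤3 : ∀ {d} → branch d ≡ excess d → d ≤ℕ 3
branch≡excess⇒≤3 {0} _ = z≤n
branch≡excess⇒≤3 {1} _ = s≤s z≤n
branch≡excess⇒≤3 {2} _ = s≤s (s≤s z≤n)
branch≡excess⇒≤3 {3} _ = ℕ.≤-refl

-- With d = 2 + excess - leaf the distance |d x - d y| is |leaf x - leaf y| + |excess x - excess y|,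
-- and |e - e′| ≥ e·[e′ = 0] + e′·[e = 0]; both are written without subtraction.
gain loss : ℕ → ℕ → ℕ
gain d e = (leaf d + excess d) + (leaf e + excess e)
loss d e = 2 * leaf d * leaf e + (excess d * branch e + branch d * excess e)

-- Equality holds as long as one of the degrees is at most 2. If both are at least 3, `gain` equals
-- `loss` and the distance is simply dropped.
gain≤distance+loss : ∀ {d e} → 1 ≤ℕ d → 1 ≤ℕ e → gain d e ≤ℕ ∣ d - e ∣ + loss d e
gain≤distance+loss {1} {1} _ _ = ℕ.≤-refl
gain≤distance+loss {1} {2} _ _ = ℕ.≤-refl
gain≤distance+loss {1} {suc (suc (suc e))} _ _ = ℕ.≤-reflexive (lemma e)
  where
  lemma : ∀ e → 2 + e ≡ 2 + e + 0
  lemma = solve-∀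
gain≤distance+loss {2} {1} _ _ = ℕ.≤-refl
gain≤distance+loss {2} {2} _ _ = ℕ.≤-refl
gain≤distance+loss {2} {suc (suc (suc e))} _ _ = ℕ.≤-reflexive (lemma e)
  where
  lemma : ∀ e → 1 + e ≡ 1 + e + 0
  lemma = solve-∀
gain≤distance+loss {suc (suc (suc d))} {1} _ _ = ℕ.≤-reflexive (lemma d)
  where
  lemma : ∀ d → 1 + d + 1 ≡ 2 + d + ((1 + d) * 0 + 0)
  lemma = solve-∀
gain≤distance+loss {suc (suc (suc d))} {2} _ _ = ℕ.≤-reflexive (lemma d)
  where
  lemma : ∀ d → 1 + d + 0 ≡ 1 + d + ((1 + d) * 0 + 0)
  lemma = solve-∀
gain≤distance+loss {suc (suc (suc d))} {suc (suc (suc e))} _ _ =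
  ≤-trans (ℕ.≤-reflexive (lemma d e)) (ℕ.m≤n+m _ ∣ d - e ∣)
  where
  lemma : ∀ d e → 1 + d + (1 + e) ≡ (1 + d) * 1 + 1 * (1 + e)
  lemma = solve-∀

-- Two degrees that are at least 3 must now both be 3, so the dropped distance is 0.
distance+loss≡gain : ∀ {d e} → 1 ≤ℕ d → d ≤ℕ 3 → 1 ≤ℕ e → e ≤ℕ 3 →
  ∣ d - e ∣ + loss d e ≡ gain d e
distance+loss≡gain {1} {1} _ _ _ _ = refl
distance+loss≡gain {1} {2} _ _ _ _ = refl
distance+loss≡gain {1} {3} _ _ _ _ = refl
distance+loss≡gain {2} {1} _ _ _ _ = refl
distance+loss≡gain {2} {2} _ _ _ _ = refl
distance+loss≡gain {2} {3} _ _ _ _ = refl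
distance+loss≡gain {3} {1} _ _ _ _ = refl
distance+loss≡gain {3} {2} _ _ _ _ = refl
distance+loss≡gain {3} {3} _ _ _ _ = refl
distance+loss≡gain {d} {suc (suc (suc (suc e)))} _ _ _ (s≤s (s≤s (s≤s ())))
distance+loss≡gain {suc (suc (suc (suc d)))} {e} _ (s≤s (s≤s (s≤s ()))) _ _

-- Summing the distances over all pairs of vertices

distanceSum : (Fin n → ℕ) → ℕ
distanceSum d = sum (λ x → sum (λ y → ∣ d x - d y ∣))

module _ (d : Fin n → ℕ) where
  private
    ℓ = sum (leaf ∘ d)
    e = sum (excess ∘ d)
    b = sum (branch ∘ d)

  gain-sum : sum (λ x → sum (λ y → gain (d x) (d y))) ≡ n * (ℓ + e) + n * (ℓ + e)
  gain-sum = trans (∑∑-+ (λ x → leaf (d x) + excess (d x)))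
    (cong (λ s → n * s + n * s) (∑-distrib-+ (leaf ∘ d) (excess ∘ d)))

  loss-sum : sum (λ x → sum (λ y → loss (d x) (d y))) ≡ 2 * ℓ * ℓ + (e * b + b * e)
  loss-sum = begin
    sum (λ x → sum (λ y → loss (d x) (d y)))
      ≡⟨ ∑∑-distrib-+ (λ x y → 2 * leaf (d x) * leaf (d y)) mixed ⟩
    sum (λ x → sum (λ y → 2 * leaf (d x) * leaf (d y))) + sum (sum ∘ mixed)
      ≡⟨ cong₂ _+_ (∑∑-distrib-* (λ x → 2 * leaf (d x)) (leaf ∘ d))
           (∑∑-distrib-+ (λ x y → excess (d x) * branch (d y)) (λ x y → branch (d x) * excess (d y))) ⟩
    sum (λ x → 2 * leaf (d x)) * ℓ +
      (sum (λ x → sum (λ y → excess (d x) * branch (d y))) +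
       sum (λ x → sum (λ y → branch (d x) * excess (d y))))
      ≡⟨ cong₂ _+_ (cong (_* ℓ) (sym (*-distribˡ-sum 2 (leaf ∘ d))))
           (cong₂ _+_ (∑∑-distrib-* (excess ∘ d) (branch ∘ d)) (∑∑-distrib-* (branch ∘ d) (excess ∘ d))) ⟩
    2 * ℓ * ℓ + (e * b + b * e) ∎
    where
    open ≡-Reasoning
    mixed : Fin n → Fin n → ℕ
    mixed x y = excess (d x) * branch (d y) + branch (d x) * excess (d y)

  distance+loss-sum : sum (λ x → sum (λ y → ∣ d x - d y ∣ + loss (d x) (d y))) ≡
    distanceSum d + (2 * ℓ * ℓ + (e * b + b * e))
  distance+loss-sum = trans
    (∑∑-distrib-+ (λ x y → ∣ d x - d y ∣) (λ x y → loss (d x) (d y)))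
    (cong (λ s → distanceSum d + s) loss-sum)

  -- Once `ℓ = e` is known, this reads `4 n ℓ ≤ distanceSum d + 2 ℓ² + 2 ℓ b`.
  distanceSum-≥ : (∀ x → 1 ≤ℕ d x) →
    n * (ℓ + e) + n * (ℓ + e) ≤ℕ distanceSum d + (2 * ℓ * ℓ + (e * b + b * e))
  distanceSum-≥ 1≤d = subst₂ _≤ℕ_ gain-sum distance+loss-sum
    (sum-mono-≤ λ x → sum-mono-≤ λ y → gain≤distance+loss (1≤d x) (1≤d y))

  distanceSum-≡ : (∀ x → 1 ≤ℕ d x) → (∀ x → d x ≤ℕ 3) →
    distanceSum d + (2 * ℓ * ℓ + (e * b + b * e)) ≡ n * (ℓ + e) + n * (ℓ + e)
  distanceSum-≡ 1≤d d≤3 = trans (sym distance+loss-sum) (trans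
    (sum-cong-≗ λ x → sum-cong-≗ λ y → distance+loss≡gain (1≤d x) (d≤3 x) (1≤d y) (d≤3 y))
    gain-sum)

  -- The average degree is 2, so the total deviations from 2 downwards and upwards balance.
  leaf≡excess : (∀ x → 1 ≤ℕ d x) → sum d ≡ n + n → ℓ ≡ e
  leaf≡excess 1≤d ∑d≡2n = ℕ.+-cancelˡ-≡ (sum d) _ _ (begin
    sum d + ℓ                      ≡⟨ ∑-distrib-+ d (leaf ∘ d) ⟨
    sum (λ x → d x + leaf (d x))   ≡⟨ sum-cong-≗ (λ x → degree+leaf (1≤d x)) ⟩
    sum (λ x → 2 + excess (d x))   ≡⟨ ∑-distrib-+ (λ _ → 2) (excess ∘ d) ⟩
    sum {n} (λ _ → 2) + e          ≡⟨ cong (_+ e) (sum-const n 2) ⟩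
    n * 2 + e                      ≡⟨ cong (_+ e) (*2 n) ⟩
    n + n + e                      ≡⟨ cong (_+ e) ∑d≡2n ⟨
    sum d + e ∎)
    where
    open ≡-Reasoning
    *2 : ∀ n → n * 2 ≡ n + n
    *2 = solve-∀

  leaf+through+branch-sum : (∀ x → 1 ≤ℕ d x) → ℓ + (sum (through ∘ d) + b) ≡ n
  leaf+through+branch-sum 1≤d = begin
    ℓ + (sum (through ∘ d) + b)
      ≡⟨ cong (λ s → ℓ + s) (∑-distrib-+ (through ∘ d) (branch ∘ d)) ⟨
    ℓ + sum (λ x → through (d x) + branch (d x))
      ≡⟨ ∑-distrib-+ (leaf ∘ d) (λ x → through (d x) + branch (d x)) ⟨
    sum (λ x → leaf (d x) + (through (d x) + branch (d x)))
      ≡⟨ sum-cong-≗ (λ x → leaf+through+branch (1≤d x)) ⟩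
    sum {n} (λ _ → 1)
      ≡⟨ trans (sum-const n 1) (ℕ.*-identityʳ n) ⟩
    n ∎
    where open ≡-Reasoning

  excess≤1⇒branch≡excess : e ≤ℕ 1 → ∀ x → branch (d x) ≡ excess (d x)
  excess≤1⇒branch≡excess e≤1 x = excess≤1⇒branch (≤-trans (term≤sum (excess ∘ d) x) e≤1)

-- With ℓ = k + 4 the difference of the two sides is 2 (k (k + 4) + k p + (2 k + 4) z + 8).
few-branches-bound : ∀ ℓ p z → let n = ℓ + p + z in 2 ≤ℕ ℓ → p ≤ℕ ℓ →
  (ℓ ≡ 2 × p ≡ 2) ⊎ 8 * n + (2 * ℓ * ℓ + (ℓ * p + p * ℓ)) < n * (ℓ + ℓ) + n * (ℓ + ℓ) + 16
few-branches-bound 1 p z (s≤s ()) _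
-- For `ℓ = 2` the terms in `n` cancel and the two sides differ by `8 - 4 p`, so only `p = 2` is
-- exceptional. The slacks 7 and 3 are one less than 8 and 4 because the inequality is strict.
few-branches-bound 2 0 z _ _ = inj₂ (ℕ.≤-trans (m≤m+n _ 7) (ℕ.≤-reflexive (lemma z)))
  where
  lemma : ∀ z → 1 + (8 * (2 + z) + 8) + 7 ≡ (2 + z) * 4 + (2 + z) * 4 + 16
  lemma = solve-∀
few-branches-bound 2 1 z _ _ = inj₂ (ℕ.≤-trans (m≤m+n _ 3) (ℕ.≤-reflexive (lemma z)))
  where
  lemma : ∀ z → 1 + (8 * (3 + z) + 12) + 3 ≡ (3 + z) * 4 + (3 + z) * 4 + 16
  lemma = solve-∀
few-branches-bound 2 2 z _ _ = inj₁ (refl , refl)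
few-branches-bound 2 (suc (suc (suc p))) z _ (s≤s (s≤s ()))
-- The difference is `10 - 2 p + 4 z = 2 (3 - p) + 4 z + 4`, nonnegative thanks to `p ≤ 3`. For the
-- ring solver `3 ∸ p` is generalised to `q`, and `p + q = 3` enters between its two uses.
few-branches-bound 3 p z _ p≤3 =
  inj₂ (ℕ.≤-trans (m≤m+n _ (2 * (3 ∸ p) + 4 * z + 3)) (ℕ.≤-reflexive (begin
    1 + (8 * (3 + p + z) + (18 + (3 * p + p * 3))) + (2 * (3 ∸ p) + 4 * z + 3)
      ≡⟨ lemma₁ p (3 ∸ p) z ⟩
    46 + 12 * p + 12 * z + 2 * (p + (3 ∸ p))
      ≡⟨ cong (λ s → 46 + 12 * p + 12 * z + 2 * s) (ℕ.m+[n∸m]≡n p≤3) ⟩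
    46 + 12 * p + 12 * z + 6
      ≡⟨ lemma₂ p z ⟩
    (3 + p + z) * 6 + (3 + p + z) * 6 + 16 ∎)))
  where
  open ≡-Reasoning
  lemma₁ : ∀ p q z → 1 + (8 * (3 + p + z) + (18 + (3 * p + p * 3))) + (2 * q + 4 * z + 3) ≡
    46 + 12 * p + 12 * z + 2 * (p + q)
  lemma₁ = solve-∀
  lemma₂ : ∀ p z → 46 + 12 * p + 12 * z + 6 ≡ (3 + p + z) * 6 + (3 + p + z) * 6 + 16
  lemma₂ = solve-∀
few-branches-bound (suc (suc (suc (suc k)))) p z _ _ =
  inj₂ (ℕ.≤-trans (m≤m+n _ (2 * (k * (k + 4) + k * p + (2 * k + 4) * z + 7) + 1)) (ℕ.≤-reflexive (lemma k p z)))
  where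
  lemma : ∀ k p z →
    1 + (8 * (4 + k + p + z) + (2 * (4 + k) * (4 + k) + ((4 + k) * p + p * (4 + k)))) +
    (2 * (k * (k + 4) + k * p + (2 * k + 4) * z + 7) + 1) ≡
    (4 + k + p + z) * (4 + k + (4 + k)) + (4 + k + p + z) * (4 + k + (4 + k)) + 16
  lemma = solve-∀

-- Degree sequences with entries in {1, 2, 3}

sum-zeros : (f : ℕ → ℕ) {xs : List ℕ} → All (λ x → f x ≡ 0) xs → List.sum (map f xs) ≡ 0
sum-zeros f []             = refl
sum-zeros f (fx≡0 ∷ fxs≡0) = cong₂ _+_ fx≡0 (sum-zeros f fxs≡0)

blocks : ℕ → ℕ → ℕ → List ℕ
blocks i j k = replicate i 3 ++ replicate j 2 ++ replicate k 1

-- The head bounds the tail, so no larger value follows it: the blocks of larger values are empty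
-- and the head can be placed at the front of its own block.
descending⇒blocks : ∀ {xs} → AllPairs ℕ._≥_ xs → All (λ x → 1 ≤ℕ x × x ≤ℕ 3) xs →
  xs ≡ blocks (List.sum (map branch xs)) (List.sum (map through xs)) (List.sum (map leaf xs))
descending⇒blocks [] [] = refl
descending⇒blocks {1 ∷ xs} (1≥xs ∷ ↘xs) (_ ∷ ok) = begin
    1 ∷ xs                                        ≡⟨ cong (1 ∷_) (descending⇒blocks ↘xs ok) ⟩
    -- The zero counts are evaluated so that the new entry reaches its block, and then restored.
    1 ∷ blocks ∑branch ∑through ∑leaf             ≡⟨ cong₂ (λ i j → 1 ∷ blocks i j ∑leaf) branch≡0 through≡0 ⟩
    blocks 0 0 (suc ∑leaf)                        ≡⟨ cong₂ (λ i j → blocks i j (suc ∑leaf)) branch≡0 through≡0 ⟨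
    blocks ∑branch ∑through (suc ∑leaf)           ∎
  where
  open ≡-Reasoning
  ∑branch  = List.sum (map branch xs)
  ∑through = List.sum (map through xs)
  ∑leaf    = List.sum (map leaf xs)
  branch≡0 : ∑branch ≡ 0
  branch≡0 = sum-zeros branch (All.map (λ x≤1 → ≤2⇒branch≡0 (ℕ.m≤n⇒m≤1+n x≤1)) 1≥xs)
  through≡0 : ∑through ≡ 0
  through≡0 = sum-zeros through (All.map ≤1⇒through≡0 1≥xs)
descending⇒blocks {2 ∷ xs} (2≥xs ∷ ↘xs) (_ ∷ ok) = begin
    2 ∷ xs                                        ≡⟨ cong (2 ∷_) (descending⇒blocks ↘xs ok) ⟩
    2 ∷ blocks ∑branch ∑through ∑leaf             ≡⟨ cong (λ i → 2 ∷ blocks i ∑through ∑leaf) branch≡0 ⟩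
    blocks 0 (suc ∑through) ∑leaf                 ≡⟨ cong (λ i → blocks i (suc ∑through) ∑leaf) branch≡0 ⟨
    blocks ∑branch (suc ∑through) ∑leaf           ∎
  where
  open ≡-Reasoning
  ∑branch  = List.sum (map branch xs)
  ∑through = List.sum (map through xs)
  ∑leaf    = List.sum (map leaf xs)
  branch≡0 : ∑branch ≡ 0
  branch≡0 = sum-zeros branch (All.map ≤2⇒branch≡0 2≥xs)
descending⇒blocks {3 ∷ xs} (_ ∷ ↘xs) (_ ∷ ok) = cong (3 ∷_) (descending⇒blocks ↘xs ok)
descending⇒blocks {suc (suc (suc (suc _))) ∷ _} (_ ∷ _) ((_ , s≤s (s≤s (s≤s ()))) ∷ _)

module _ (G : SimpleGraph n) (1≤deg : ∀ x → 1 ≤ℕ degree G x) where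
  private
    ℓ = sum (leaf ∘ degree G)
    t = sum (through ∘ degree G)
    b = sum (branch ∘ degree G)

  -- The three counts add up to `n`, so the number of twos is determined by `ℓ` and `b`.
  degreeSequence-blocks : (∀ x → degree G x ≤ℕ 3) → degreeSequence G ≡ blocks b (n ∸ (ℓ + b)) ℓ
  degreeSequence-blocks deg≤3 = begin
    degreeSequence G
      ≡⟨ descending⇒blocks (Linked⇒AllPairs (λ i≥j j≥k → ≤-trans j≥k i≥j) (sort-↗ degrees))
           (All-resp-↭ (↭-sym (sort-↭ degrees))
             (All.map⁺ (All.tabulate⁺ λ x → 1≤deg x , deg≤3 x))) ⟩
    blocks (total branch) (total through) (total leaf)
      ≡⟨ cong₂ (λ i j → blocks i j (total leaf))
           (sum-degreeSequence G branch) (sum-degreeSequence G through) ⟩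
    blocks b t (total leaf)
      ≡⟨ cong₂ (blocks b) t≡ (sum-degreeSequence G leaf) ⟩
    blocks b (n ∸ (ℓ + b)) ℓ ∎
    where
    open ≡-Reasoning
    degrees = map (degree G) (allFin n)
    total : (ℕ → ℕ) → ℕ
    total f = List.sum (map f (degreeSequence G))
    swap-middle : ∀ t ℓ b → ℓ + (t + b) ≡ ℓ + b + t
    swap-middle = solve-∀
    t≡ : t ≡ n ∸ (ℓ + b)
    t≡ = begin
      t                         ≡⟨ ℕ.m+n∸m≡n (ℓ + b) t ⟨
      ℓ + b + t ∸ (ℓ + b)       ≡⟨ cong (_∸ (ℓ + b)) (swap-middle t ℓ b) ⟨
      ℓ + (t + b) ∸ (ℓ + b)     ≡⟨ cong (_∸ (ℓ + b)) (leaf+through+branch-sum (degree G) 1≤deg) ⟩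
      n ∸ (ℓ + b)               ∎

-- Connected graphs with all degrees 2

length≡2⇒pair : (xs : List A) → length xs ≡ 2 → ∃ λ y → ∃ λ z → xs ≡ y ∷ z ∷ []
length≡2⇒pair (y ∷ z ∷ []) refl = y , z , refl

-- `Next` on bare indices with modulus `j`; at `toℕ i` and `toℕ k` it unfolds to the same type as
-- `Next i k`.
CyclicStep : ℕ → ℕ → ℕ → Set
CyclicStep j a b = suc a ≡ b ⊎ (suc a ≡ j × b ≡ 0)

module TwoRegular (G : SimpleGraph n) (conn : Connected G) (degree≡2 : ∀ x → degree G x ≡ 2) where
  open SimpleGraph G using (_~_; _~?_; ~-sym; ~-irrefl)

  two-neighbours : ∀ x → ∃ λ y → ∃ λ z → y ≢ z × x ~ y × x ~ z × (∀ w → x ~ w → w ≡ y ⊎ w ≡ z)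
  two-neighbours x with length≡2⇒pair (filter (x ~?_) (allFin n)) (degree≡2 x)
  ... | y , z , eq = y , z , distinct , neighbour (here refl) , neighbour (there (here refl)) , only
    where
    distinct : y ≢ z
    distinct with subst Unique eq (Unique.filter⁺ (x ~?_) (Unique.allFin⁺ n))
    ... | (y≢z ∷ []) ∷ _ = y≢z
    neighbour : ∀ {w} → w ∈ y ∷ z ∷ [] → x ~ w
    neighbour {w} w∈ = proj₂ (∈-filter⁻ (x ~?_) {xs = allFin n} (subst (w ∈_) (sym eq) w∈))
    only : ∀ w → x ~ w → w ≡ y ⊎ w ≡ z
    only w x~w with subst (w ∈_) eq (∈-filter⁺ (x ~?_) (∈-allFin w) x~w)
    ... | here w≡y         = inj₁ w≡y
    ... | there (here w≡z) = inj₂ w≡z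

  -- The rule of the walk: having come to `x` from `y`, leave by the other edge.
  other-neighbour : ∀ {x y} → x ~ y → ∃ λ z → x ~ z × z ≢ y × (∀ w → x ~ w → w ≡ y ⊎ w ≡ z)
  other-neighbour {x} {y} x~y with two-neighbours x
  ... | u , v , u≢v , x~u , x~v , only with only y x~y
  ...   | inj₁ refl = v , x~v , u≢v ∘ sym , only
  ...   | inj₂ refl = u , x~u , u≢v , λ w x~w → swap (only w x~w)

  -- Non-backtracking walks and their first repeated vertex

  module Walk (v : ℕ → Fin n)
    (v-step : ∀ k → v k ~ v (suc k))
    (no-backtrack : ∀ k → v (suc (suc k)) ≢ v k)
    (neighbours : ∀ k {w} → v (suc k) ~ w → w ≡ v k ⊎ w ≡ v (suc (suc k)))
    where

    no-loop : ∀ k → v k ≢ v (suc k)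
    no-loop k eq = ~-irrefl (subst (v k ~_) (sym eq) (v-step k))

    Distinct : ℕ → Set
    Distinct k = ∀ {a b} → a < b → b < k → v a ≢ v b

    distinct-injective : ∀ {k} → Distinct k → ∀ {a b} → a < k → b < k → v a ≡ v b → a ≡ b
    distinct-injective dist {a} {b} a<k b<k eq with ℕ.<-cmp a b
    ... | tri< a<b _ _ = contradiction eq (dist a<b b<k)
    ... | tri≈ _ a≡b _ = a≡b
    ... | tri> _ _ b<a = contradiction (sym eq) (dist b<a a<k)

    distinct-toℕ : ∀ {k} → Distinct k → ∀ {i j : Fin k} → v (toℕ i) ≡ v (toℕ j) → i ≡ j
    distinct-toℕ dist {i} {j} eq =
      Fin.toℕ-injective (distinct-injective dist (Fin.toℕ<n i) (Fin.toℕ<n j) eq)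

    FirstRepeat : ℕ → Set
    FirstRepeat j = Distinct j × ∃ λ i → i < j × v i ≡ v j

    distinct? : ∀ k → Distinct k ⊎ ∃ FirstRepeat
    distinct? zero = inj₁ λ _ ()
    distinct? (suc k) with distinct? k
    ... | inj₂ found = inj₂ found
    ... | inj₁ dist with ℕ.anyUpTo? (λ i → v i Fin.≟ v k) k
    ...   | yes (i , i<k , eq) = inj₂ (k , dist , i , i<k , eq)
    ...   | no ¬eq = inj₁ λ {a} {b} a<b b<1+k → case-≤ a<b (ℕ.m≤n⇒m<n∨m≡n (s≤s⁻¹ b<1+k))
      where
      case-≤ : ∀ {a b} → a < b → b < k ⊎ b ≡ k → v a ≢ v b
      case-≤ a<b (inj₁ b<k)  = dist a<b b<k
      case-≤ a<b (inj₂ refl) eq = ¬eq (_ , a<b , eq)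

    -- Pigeonhole: `n + 1` vertices of the walk cannot all be distinct.
    firstRepeat : ∃ FirstRepeat
    firstRepeat with distinct? (suc n)
    ... | inj₂ found = found
    ... | inj₁ dist  = contradiction (Fin.injective⇒≤ (distinct-toℕ dist)) ℕ.1+n≰n

    -- A first repeat v i = v j with i > 0 would repeat a neighbour of v i one step earlier.
    repeats-start : ∀ {i j} → Distinct j → i < j → v i ≡ v j → i ≡ 0
    repeats-start {zero} _ _ _ = refl
    repeats-start {suc i} {suc j} dist (s≤s i<j) eq
      with neighbours i (subst (_~ v j) (sym eq) (~-sym (v-step j)))
    ... | inj₁ vj≡vi = contradiction (sym vj≡vi) (dist i<j ℕ.≤-refl)
    -- If `2 + i < j`, this is an earlier repeat. Otherwise the given repeat is a backtrack
    -- (`j = 2 + i`) or a loop (`j = 1 + i`).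
    ... | inj₂ vj≡v[2+i] with ℕ.<-cmp (2 + i) j
    ...   | tri< 2+i<j _ _  = contradiction (sym vj≡v[2+i]) (dist 2+i<j ℕ.≤-refl)
    ...   | tri≈ _ refl _   = contradiction (sym eq) (no-backtrack (suc i))
    ...   | tri> _ _ j<2+i with ℕ.≤-antisym i<j (s≤s⁻¹ j<2+i)
    ...     | refl = contradiction eq (no-loop (suc i))

    -- A closed walk as an isomorphism with a cycle

    module Closed {m} (dist : Distinct (3 + m)) (closed : v 0 ≡ v (3 + m)) where
      j : ℕ
      j = 3 + m

      -- As a neighbour of `v 0 = v j`, the vertex `v 1` is `v (j - 1)` or `v (j + 1)`; the former
      -- contradicts distinctness since `1 < j - 1`.
      v[1+j]≡v1 : v (suc j) ≡ v 1
      v[1+j]≡v1 with neighbours (2 + m) (subst (_~ v 1) closed (v-step 0))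
      ... | inj₁ v1≡v[2+m] = contradiction v1≡v[2+m] (dist (s≤s (s≤s z≤n)) ℕ.≤-refl)
      ... | inj₂ v1≡v[4+m] = sym v1≡v[4+m]

      successor : ∀ a → a < j → ∃ λ b → b < j × v (suc a) ≡ v b × CyclicStep j a b
      successor a a<j with ℕ.m≤n⇒m<n∨m≡n a<j
      ... | inj₁ 1+a<j = suc a , 1+a<j , refl , inj₁ refl
      ... | inj₂ 1+a≡j = 0 , s≤s z≤n , trans (cong v 1+a≡j) (sym closed) , inj₂ (1+a≡j , refl)

      -- v 0 is treated as v j, whose neighbours are v (j - 1) and v (j + 1) = v 1.
      neighbour-index : ∀ a {w} → a < j → v a ~ w →
        ∃ λ b → b < j × w ≡ v b × (CyclicStep j a b ⊎ CyclicStep j b a)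
      neighbour-index zero a<j v0~w with neighbours (2 + m) (subst (_~ _) closed v0~w)
      ... | inj₁ w≡ = 2 + m , ℕ.≤-refl , w≡ , inj₂ (inj₂ (refl , refl))
      ... | inj₂ w≡ = 1 , s≤s (s≤s z≤n) , trans w≡ v[1+j]≡v1 , inj₁ (inj₁ refl)
      neighbour-index (suc a) a<j va~w with neighbours a va~w
      ... | inj₁ w≡ = a , ℕ.<⇒≤ a<j , w≡ , inj₂ (inj₁ refl)
      ... | inj₂ w≡ with successor (suc a) a<j
      ...   | b , b<j , eq , step = b , b<j , trans w≡ eq , inj₁ step

      Reached : Fin n → Set
      Reached x = ∃ λ a → a < j × x ≡ v a

      -- All neighbours of a vertex on the walk lie on the walk again, so no path leaves it; by
      -- connectivity the walk visits every vertex.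
      reached-star : ∀ {x y} → Star _~_ x y → Reached x → Reached y
      reached-star ε r = r
      reached-star (x~z ◅ z⋯y) (a , a<j , refl) with neighbour-index a a<j x~z
      ... | b , b<j , eq , _ = reached-star z⋯y (b , b<j , eq)

      reached : ∀ x → Reached x
      reached x = reached-star (conn (v 0) x) (0 , s≤s z≤n , refl)

      to : Fin n → Fin j
      to x = fromℕ< (proj₁ (proj₂ (reached x)))

      from : Fin j → Fin n
      from i = v (toℕ i)

      toℕ-to : ∀ x → toℕ (to x) ≡ proj₁ (reached x)
      toℕ-to x = Fin.toℕ-fromℕ< _

      from-to : ∀ x → from (to x) ≡ x
      from-to x = trans (cong v (toℕ-to x)) (sym (proj₂ (proj₂ (reached x))))

      to-from : ∀ i → to (from i) ≡ i
      to-from i = distinct-toℕ dist (from-to (from i))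

      step⇒adjacent : ∀ {i k} → Next i k → from i ~ from k
      step⇒adjacent {i} (inj₁ eq) = subst (λ a → from i ~ v a) eq (v-step (toℕ i))
      step⇒adjacent {i} {k} (inj₂ (1+i≡j , k≡0)) = subst (from i ~_)
        (trans (cong v 1+i≡j) (trans (sym closed) (cong v (sym k≡0)))) (v-step (toℕ i))

      adjacent⇒step : ∀ {i k} → from i ~ from k → Next i k ⊎ Next k i
      adjacent⇒step {i} {k} i~k with neighbour-index (toℕ i) (Fin.toℕ<n i) i~k
      ... | b , b<j , eq , step with distinct-injective dist (Fin.toℕ<n k) b<j eq
      ...   | refl = step

      n≤j : n ≤ℕ j
      n≤j = Fin.injective⇒≤ {f = to} λ {x} {y} eq →
        trans (sym (from-to x)) (trans (cong from eq) (from-to y))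

      j≤n : j ≤ℕ n
      j≤n = Fin.injective⇒≤ (distinct-toℕ dist)

      -- The proof of the bound is a parameter so that the statement can be transported along
      -- `j ≡ n` and still meet any given proof of `3 ≤ n`.
      ≅cycle : (3≤j : 3 ≤ℕ j) → G ≅ C j 3≤j
      ≅cycle 3≤j = permutation to from to-from from-to , λ x y → mk⇔
        (λ x~y → adjacent⇒step (subst₂ _~_ (sym (from-to x)) (sym (from-to y)) x~y))
        (λ where
          (inj₁ next) → subst₂ _~_ (from-to x) (from-to y) (step⇒adjacent next)
          (inj₂ next) → ~-sym (subst₂ _~_ (from-to y) (from-to x) (step⇒adjacent next)))

      ≅C : (3≤n : 3 ≤ℕ n) → G ≅ C n 3≤n
      ≅C = subst (λ k → (3≤k : 3 ≤ℕ k) → G ≅ C k 3≤k) (ℕ.≤-antisym j≤n n≤j) ≅cycle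

    closed-walk⇒≅C : ∃ FirstRepeat → (3≤n : 3 ≤ℕ n) → G ≅ C n 3≤n
    closed-walk⇒≅C (j , dist , i , i<j , eq) with repeats-start dist i<j eq
    -- Closing up after one step would be a loop, after two steps a backtrack.
    closed-walk⇒≅C (1 , dist , _ , _ , eq) | refl = contradiction eq (no-loop 0)
    closed-walk⇒≅C (2 , dist , _ , _ , eq) | refl = contradiction (sym eq) (no-backtrack 0)
    closed-walk⇒≅C (suc (suc (suc m)) , dist , _ , _ , eq) | refl = Closed.≅C dist eq

  -- An oriented edge. The state of the walk has to remember the previous vertex, since the next one
  -- is the neighbour of `head` other than `tail`.
  record Dart : Set where
    constructor dart
    field
      {tail head} : Fin n
      tail~head   : tail ~ head
  open Dart

  advance : Dart → Dart
  advance (dart x~y) = dart (proj₁ (proj₂ (other-neighbour (~-sym x~y))))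

  two-regular⇒≅C : (3≤n : 3 ≤ℕ n) → G ≅ C n 3≤n
  two-regular⇒≅C 3≤n = closed-walk⇒≅C firstRepeat 3≤n
    where
    walk : ℕ → Dart
    -- `3≤n` is read as `2 < n`, so the walk starts at the vertex with index 2.
    walk zero    = dart (proj₁ (proj₂ (proj₂ (proj₂ (two-neighbours (fromℕ< 3≤n))))))
    walk (suc k) = advance (walk k)
    other : ∀ k → ∃ λ z → head (walk k) ~ z × z ≢ tail (walk k) ×
      (∀ w → head (walk k) ~ w → w ≡ tail (walk k) ⊎ w ≡ z)
    other k = other-neighbour (~-sym (tail~head (walk k)))
    open Walk (tail ∘ walk) (tail~head ∘ walk) (λ k → proj₁ (proj₂ (proj₂ (other k))))
      (λ k → proj₂ (proj₂ (proj₂ (other k))) _)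

-- Halves of integers

-- `mkℚᵘ` stores the denominator less one, so the right side is `i / 2`. Among unnormalised
-- rationals no reduction to lowest terms gets in the way.
half≃ : ∀ i → toℚᵘ (½ ℚ.* (i / 1)) ℚᵘ.≃ mkℚᵘ i 1
half≃ i = ℚᵘ.≃-trans (ℚ.toℚᵘ-homo-* ½ (i / 1)) (ℚᵘ.≃-trans
  (ℚᵘ.*-congˡ {toℚᵘ ½} (ℚ.toℚᵘ-fromℚᵘ (mkℚᵘ i 0)))
  (*≡* (cong (ℤ._* + 2) (ℤ.*-identityˡ i))))

half-≥ : ∀ s t → t * 2 ≤ℕ s → ½ ℚ.* (+ s / 1) ≥ + t / 1
half-≥ s t 2t≤s = ℚ.toℚᵘ-cancel-≤
  (ℚᵘ.≤-respʳ-≃ (ℚᵘ.≃-sym (half≃ (+ s)))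
  (ℚᵘ.≤-respˡ-≃ (ℚᵘ.≃-sym (ℚ.toℚᵘ-fromℚᵘ (mkℚᵘ (+ t) 0)))
  (*≤* (subst₂ ℤ._≤_ (ℤ.pos-* t 2) (sym (ℤ.*-identityʳ (+ s))) (ℤ.+≤+ 2t≤s)))))

half-≡ : ∀ s t → ½ ℚ.* (+ s / 1) ≡ + t / 1 ⇔ t * 2 ≡ s
half-≡ s t = mk⇔
  (λ eq → ℤ.+-injective (trans (ℤ.pos-* t 2) (trans (numerators eq) (ℤ.*-identityʳ (+ s)))))
  (λ eq → ℚ.toℚᵘ-injective (ℚᵘ.≃-trans (half≃ (+ s)) (ℚᵘ.≃-trans
    (*≡* (trans (ℤ.*-identityʳ (+ s)) (trans (cong +_ (sym eq)) (ℤ.pos-* t 2))))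
    (ℚᵘ.≃-sym (ℚ.toℚᵘ-fromℚᵘ (mkℚᵘ (+ t) 0))))))
  where
  numerators : ½ ℚ.* (+ s / 1) ≡ + t / 1 → + t ℤ.* + 2 ≡ + s ℤ.* + 1
  numerators eq with ℚᵘ.≃-trans (ℚᵘ.≃-sym (ℚ.toℚᵘ-fromℚᵘ (mkℚᵘ (+ t) 0)))
                       (ℚᵘ.≃-trans (ℚᵘ.≃-reflexive (cong toℚᵘ (sym eq))) (half≃ (+ s)))
  ... | *≡* eq′ = eq′

-- Unicyclic graphs

sum-map-replicate-++ : (f : ℕ → ℕ) → ∀ {x} → f x ≡ 0 → ∀ k {ys} →
  List.sum (map f (replicate k x ++ ys)) ≡ List.sum (map f ys)
sum-map-replicate-++ f fx≡0 zero    = refl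
sum-map-replicate-++ f fx≡0 (suc k) = cong₂ _+_ fx≡0 (sum-map-replicate-++ f fx≡0 k)

module Counts {n} (5≤n : 5 ≤ℕ n) (G : SimpleGraph n) (uni : Unicyclic G) where
  ℓ e b t : ℕ
  ℓ = sum (leaf ∘ degree G)
  e = sum (excess ∘ degree G)
  b = sum (branch ∘ degree G)
  t = sum (through ∘ degree G)

  3≤n : 3 ≤ℕ n
  3≤n = ≤-trans (m≤m+n 3 2) 5≤n

  1≤deg : ∀ x → 1 ≤ℕ degree G x
  1≤deg = 1≤degree G (≤-trans (m≤m+n 2 3) 5≤n) (proj₁ uni)

  ℓ≡e : ℓ ≡ e
  ℓ≡e = leaf≡excess (degree G) 1≤deg (trans (handshake G) (cong (λ k → k + k) (proj₂ uni)))

  b≤ℓ : b ≤ℕ ℓ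
  b≤ℓ = subst (b ≤ℕ_) (sym ℓ≡e) (sum-mono-≤ (branch≤excess ∘ degree G))

  -- Without leaves the total excess vanishes too, which leaves only degree 2.
  ℓ≡0⇒≅C : ℓ ≡ 0 → G ≅ C n 3≤n
  ℓ≡0⇒≅C ℓ≡0 = TwoRegular.two-regular⇒≅C G (proj₁ uni) degree≡2 3≤n
    where
    vanishes : (f : ℕ → ℕ) → sum (f ∘ degree G) ≡ 0 → ∀ x → f (degree G x) ≡ 0
    vanishes f ∑≡0 x = ℕ.n≤0⇒n≡0 (subst (f (degree G x) ≤ℕ_) ∑≡0 (term≤sum (f ∘ degree G) x))
    degree≡2 : ∀ x → degree G x ≡ 2
    degree≡2 x = begin
      degree G x                       ≡⟨ ℕ.+-identityʳ _ ⟨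
      degree G x + 0                   ≡⟨ cong (λ k → degree G x + k) (vanishes leaf ℓ≡0 x) ⟨
      degree G x + leaf (degree G x)   ≡⟨ degree+leaf (1≤deg x) ⟩
      2 + excess (degree G x)          ≡⟨ cong (λ k → 2 + k) (vanishes excess (trans (sym ℓ≡e) ℓ≡0) x) ⟩
      2 ∎
      where open ≡-Reasoning

  sequence : ∀ {k} → ℓ ≡ k → b ≡ k → (∀ x → branch (degree G x) ≡ excess (degree G x)) →
    degreeSequence G ≡ blocks k (n ∸ (k + k)) k
  sequence refl b≡ℓ branch≡excess = trans
    (degreeSequence-blocks G 1≤deg (λ x → branch≡excess⇒≤3 (branch≡excess x)))
    (cong (λ k → blocks k (n ∸ (ℓ + k)) ℓ) b≡ℓ)

  -- The total excess is 1, so it belongs to a single vertex, of degree 3.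
  ℓ≡1⇒sequence : ℓ ≡ 1 → degreeSequence G ≡ 3 ∷ replicate (n ∸ 2) 2 ++ 1 ∷ []
  ℓ≡1⇒sequence ℓ≡1 = sequence ℓ≡1 (trans (sum-cong-≗ branch≡excess) e≡1) branch≡excess
    where
    e≡1 : e ≡ 1
    e≡1 = trans (sym ℓ≡e) ℓ≡1
    branch≡excess : ∀ x → branch (degree G x) ≡ excess (degree G x)
    branch≡excess = excess≤1⇒branch≡excess (degree G) (ℕ.≤-reflexive e≡1)

  S : ℕ
  S = distanceSum (degree G)

  module Extremal (ℓ≡2 : ℓ ≡ 2) (b≡2 : b ≡ 2) where
    e≡2 : e ≡ 2
    e≡2 = trans (sym ℓ≡e) ℓ≡2

    branch≡excess : ∀ x → branch (degree G x) ≡ excess (degree G x)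
    branch≡excess = sum-≤-≡⇒≗ (branch≤excess ∘ degree G) (trans b≡2 (sym e≡2))

    extremal-sequence : degreeSequence G ≡ 3 ∷ 3 ∷ replicate (n ∸ 4) 2 ++ 1 ∷ 1 ∷ []
    extremal-sequence = sequence ℓ≡2 b≡2 branch≡excess

    S+16≡8n : S + 16 ≡ 8 * n
    S+16≡8n = begin
      -- The 16 is the total loss at `ℓ = e = b = 2`.
      S + (2 * 2 * 2 + (2 * 2 + 2 * 2))
        ≡⟨ cong₂ (λ k j → S + (2 * k * k + (2 * j + j * 2))) ℓ≡2 b≡2 ⟨
      S + (2 * ℓ * ℓ + (2 * b + b * 2))
        ≡⟨ cong (λ k → S + (2 * ℓ * ℓ + (k * b + b * k))) e≡2 ⟨
      S + (2 * ℓ * ℓ + (e * b + b * e))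
        ≡⟨ distanceSum-≡ (degree G) 1≤deg (λ x → branch≡excess⇒≤3 (branch≡excess x)) ⟩
      n * (ℓ + e) + n * (ℓ + e)
        ≡⟨ cong₂ (λ k j → n * (k + j) + n * (k + j)) ℓ≡2 e≡2 ⟩
      n * 4 + n * 4
        ≡⟨ lemma n ⟩
      8 * n ∎
      where
      open ≡-Reasoning
      lemma : ∀ n → n * 4 + n * 4 ≡ 8 * n
      lemma = solve-∀

  -- Both counts are read off the list; `leaf` and `branch` vanish at 2, so the block of twos
  -- contributes nothing whatever its length.
  sequence⇒extremal : degreeSequence G ≡ 3 ∷ 3 ∷ replicate (n ∸ 4) 2 ++ 1 ∷ 1 ∷ [] → ℓ ≡ 2 × b ≡ 2
  sequence⇒extremal eq = count leaf refl , count branch refl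
    where
    count : ∀ f → f 2 ≡ 0 → sum (f ∘ degree G) ≡ f 3 + (f 3 + (f 1 + (f 1 + 0)))
    count f f2≡0 = begin
      sum (f ∘ degree G)
        ≡⟨ sum-degreeSequence G f ⟨
      List.sum (map f (degreeSequence G))
        ≡⟨ cong (List.sum ∘ map f) eq ⟩
      f 3 + (f 3 + List.sum (map f (replicate (n ∸ 4) 2 ++ 1 ∷ 1 ∷ [])))
        ≡⟨ cong (λ s → f 3 + (f 3 + s)) (sum-map-replicate-++ f f2≡0 (n ∸ 4)) ⟩
      f 3 + (f 3 + (f 1 + (f 1 + 0))) ∎
      where open ≡-Reasoning

  -- The numerical bound is taken at `p = b` and `z = t`; its main term is at most `S + loss′`, and
  -- `loss′` cancels.
  extremal-or-larger : 2 ≤ℕ ℓ → (ℓ ≡ 2 × b ≡ 2) ⊎ 8 * n < S + 16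
  extremal-or-larger 2≤ℓ with few-branches-bound ℓ b t 2≤ℓ b≤ℓ
  ... | inj₁ extremal = inj₁ extremal
  ... | inj₂ larger   = inj₂ (ℕ.+-cancelʳ-< loss′ (8 * n) (S + 16) (begin-strict
    8 * n + loss′                       <⟨ subst (λ m → 8 * m + loss′ < m * (ℓ + ℓ) + m * (ℓ + ℓ) + 16)
                                             counts larger ⟩
    n * (ℓ + ℓ) + n * (ℓ + ℓ) + 16      ≤⟨ ℕ.+-monoˡ-≤ 16 S-bound ⟩
    S + loss′ + 16                      ≡⟨ rearrange S loss′ ⟩
    S + 16 + loss′                      ∎))
    where
    open ℕ.≤-Reasoning
    loss′ : ℕ
    loss′ = 2 * ℓ * ℓ + (ℓ * b + b * ℓ)
    S-bound : n * (ℓ + ℓ) + n * (ℓ + ℓ) ≤ℕ S + loss′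
    S-bound = subst (λ k → n * (ℓ + k) + n * (ℓ + k) ≤ℕ S + (2 * ℓ * ℓ + (k * b + b * k)))
      (sym ℓ≡e) (distanceSum-≥ (degree G) 1≤deg)
    rearrange : ∀ S l → S + l + 16 ≡ S + 16 + l
    rearrange = solve-∀
    shuffle : ∀ ℓ b t → ℓ + b + t ≡ ℓ + (t + b)
    shuffle = solve-∀
    counts : ℓ + b + t ≡ n
    counts = trans (shuffle ℓ b t) (leaf+through+branch-sum (degree G) 1≤deg)

  8≤4n : 8 ≤ℕ 4 * n
  8≤4n = ≤-trans (m≤m+n 8 12) (ℕ.*-monoʳ-≤ 4 5≤n)

  -- Since `8 ≤ 4 n`, nothing is truncated, and the comparison with `irrₜ` can be carried out on
  -- natural numbers.
  threshold : + (4 * n) - + 8 ≡ + (4 * n ∸ 8)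
  threshold = trans (ℤ.m-n≡m⊖n (4 * n) 8) (ℤ.⊖-≥ 8≤4n)

  twice-threshold : (4 * n ∸ 8) * 2 + 16 ≡ 8 * n
  twice-threshold = begin
    (4 * n ∸ 8) * 2 + 16     ≡⟨ ℕ.*-distribʳ-+ 2 (4 * n ∸ 8) 8 ⟨
    (4 * n ∸ 8 + 8) * 2      ≡⟨ cong (_* 2) (ℕ.m∸n+n≡m 8≤4n) ⟩
    4 * n * 2                ≡⟨ lemma n ⟩
    8 * n                    ∎
    where
    open ≡-Reasoning
    lemma : ∀ n → 4 * n * 2 ≡ 8 * n
    lemma = solve-∀

  irrₜ-≥ : 8 * n ≤ℕ S + 16 → irrₜ G ≥ (+ (4 * n) - + 8) / 1
  irrₜ-≥ 8n≤S+16 = subst (λ i → irrₜ G ≥ i / 1) (sym threshold)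
    (half-≥ S (4 * n ∸ 8) (ℕ.+-cancelʳ-≤ 16 _ _ (subst (_≤ℕ S + 16) (sym twice-threshold) 8n≤S+16)))

  irrₜ-≡ : irrₜ G ≡ (+ (4 * n) - + 8) / 1 ⇔ S + 16 ≡ 8 * n
  irrₜ-≡ = subst (λ i → irrₜ G ≡ i / 1 ⇔ S + 16 ≡ 8 * n) (sym threshold) (mk⇔
    (λ eq → trans (cong (λ k → k + 16) (sym (Equivalence.to (half-≡ S T) eq))) twice-threshold)
    (λ eq → Equivalence.from (half-≡ S T) (ℕ.+-cancelʳ-≡ 16 (T * 2) S (trans twice-threshold (sym eq)))))
    where
    T : ℕ
    T = 4 * n ∸ 8

theorem10 : ∀ (n : ℕ) (5≤n : 5 ≤ℕ n) (G : SimpleGraph n) → Unicyclic G →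
    ¬ (G ≅ C n (≤-trans (m≤m+n 3 2) 5≤n)) →
    degreeSequence G ≢ 3 ∷ replicate (n ∸ 2) 2 ++ 1 ∷ [] →
    irrₜ G ≥ (+ (4 * n) - + 8) / 1 ×
    (irrₜ G ≡ (+ (4 * n) - + 8) / 1 ⇔
      degreeSequence G ≡ 3 ∷ 3 ∷ replicate (n ∸ 4) 2 ++ 1 ∷ 1 ∷ [])
theorem10 n 5≤n G uni G≇C seq≢ = irrₜ-≥ 8n≤S+16 , mk⇔ equality⇒sequence sequence⇒equality
  where
  open Counts 5≤n G uni

  -- The two exclusions rule out `ℓ = 0` and `ℓ = 1` respectively.
  2≤ℓ : 2 ≤ℕ ℓ
  2≤ℓ = ℕ.≤∧≢⇒< (ℕ.n≢0⇒n>0 (G≇C ∘ ℓ≡0⇒≅C)) (seq≢ ∘ ℓ≡1⇒sequence ∘ sym)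

  8n≤S+16 : 8 * n ≤ℕ S + 16
  8n≤S+16 = [ (λ (ℓ≡2 , b≡2) → ℕ.≤-reflexive (sym (Extremal.S+16≡8n ℓ≡2 b≡2))) , ℕ.<⇒≤ ]′
    (extremal-or-larger 2≤ℓ)

  equality⇒sequence : irrₜ G ≡ (+ (4 * n) - + 8) / 1 →
    degreeSequence G ≡ 3 ∷ 3 ∷ replicate (n ∸ 4) 2 ++ 1 ∷ 1 ∷ []
  equality⇒sequence eq =
    [ (λ (ℓ≡2 , b≡2) → Extremal.extremal-sequence ℓ≡2 b≡2)
    , (λ 8n<S+16 → contradiction (sym (Equivalence.to irrₜ-≡ eq)) (ℕ.<⇒≢ 8n<S+16))
    ]′ (extremal-or-larger 2≤ℓ)

  sequence⇒equality : degreeSequence G ≡ 3 ∷ 3 ∷ replicate (n ∸ 4) 2 ++ 1 ∷ 1 ∷ [] →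
    irrₜ G ≡ (+ (4 * n) - + 8) / 1
  sequence⇒equality eq = let ℓ≡2 , b≡2 = sequence⇒extremal eq in
    Equivalence.from irrₜ-≡ (Extremal.S+16≡8n ℓ≡2 b≡2)
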